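{- Let $G$ be a graph of order $n$ with minimum degree $\delta$, and suppose that $G$ has a perfect matching (in the sense that, if $n$ is odd, the matching is allowed to miss exactly one vertex). Let $\epsilon=0$ if $n$ is even and $\epsilon=1$ if $n$ is odd. Then $$ \gamma_r(G)\le\frac{\ln(\delta+1)+1}{\delta+1}\,2n+\epsilon, $$ and, provided $\delta>0$, $$ \gamma_{\mathrm{tr}}(G)\le\frac{\ln\delta+1}{\delta}\,2n+\epsilon . $$
   Context: All graphs are finite and undirected, without loops or multiple edges. A matching is a set of pairwise non-adjacent edges; here a matching is called perfect if it contains all vertices of the graph when $n$ is even, or all vertices but one when $n$ is odd. A set $X\subseteq V(G)$ is a dominating set of $G$ if every vertex not in $X$ is adjacent to a vertex in $X$. A dominating set $X$ is a restrained dominating set if every vertex in $V(G)-X$ is adjacent to a vertex in $V(G)-X$; $\gamma_r(G)$ is the minimum cardinality of a restrained dominating set. A restrained dominating set $X$ is a total restrained dominating set if, in addition, every vertex of $X$ is adjacent to a vertex of $X$; $\gamma_{\mathrm{tr}}(G)$ is the minimum cardinality of a total restrained dominating set. -}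

module Defs where

open import Data.Fin using (Fin)
open import Data.Fin.Subset using (Subset; _∈_; _∉_; ∣_∣)
open import Data.Integer as ℤ using (+_)
import Data.Integer.Properties as ℤ
open import Data.Nat as ℕ using (ℕ; zero; suc; NonZero)
import Data.Nat.Properties as ℕ
open import Data.Product using (∃-syntax; _×_; _,_)
open import Data.Rational as ℚ using (ℚ; 0ℚ; 1ℚ; ½; mkℚ; Positive; toℚᵘ)
import Data.Rational.Properties as ℚ
import Data.Rational.Unnormalised as ℚᵘ
import Data.Rational.Unnormalised.Properties as ℚᵘ
open import Data.Rational.Solver using (module +-*-Solver)
open import Data.Sum using (inj₁; inj₂)
open import Data.Vec using (tabulate)
open import Relation.Binary using (Rel; Decidable; Symmetric; Irreflexive)
open import Relation.Binary.PropositionalEquality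
open import Relation.Nullary using (¬_; does)
open import Level using (0ℓ)

open +-*-Solver using (solve; _:+_; _:*_; _:-_; :-_; _:=_)

------------------------------------------------------------------------
-- Real numbers, as Cauchy sequences of rationals

Cauchy : (ℕ → ℚ) → Set
Cauchy x = ∀ ε → ε ℚ.> 0ℚ →
  ∃[ N ] (∀ m n → m ℕ.≥ N → n ℕ.≥ N → ℚ.∣ x m ℚ.- x n ∣ ℚ.< ε)

record ℝ : Set where
  constructor mkℝ
  field
    seq    : ℕ → ℚ
    cauchy : Cauchy seq

open ℝ public

infix  4 _≤ᴿ_
infixl 6 _+ᴿ_
infixl 7 _*ᴿ_ _/ᴿ_

_≤ᴿ_ : ℝ → ℝ → Set
x ≤ᴿ y = ∀ ε → ε ℚ.> 0ℚ →
  ∃[ N ] (∀ n → n ℕ.≥ N → seq x n ℚ.≤ seq y n ℚ.+ ε)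

fromℚ : ℚ → ℝ
fromℚ q = mkℝ (λ _ → q) λ ε ε>0 →
  0 , λ _ _ _ _ → subst (λ z → ℚ.∣ z ∣ ℚ.< ε) (sym (ℚ.+-inverseʳ q)) ε>0

fromℕ : ℕ → ℝ
fromℕ n = fromℚ (+ n ℚ./ 1)

private
  half>0 : ∀ {ε} → ε ℚ.> 0ℚ → ½ ℚ.* ε ℚ.> 0ℚ
  half>0 {ε} ε>0 = ℚ.positive⁻¹ (½ ℚ.* ε) {{ℚ.pos*pos⇒pos ½ ε {{ℚ.positive ε>0}}}}

  halves : ∀ ε → ½ ℚ.* ε ℚ.+ ½ ℚ.* ε ≡ ε
  halves ε = trans (sym (ℚ.*-distribʳ-+ ε ½ ½)) (ℚ.*-identityˡ ε)

  p≤∣p∣ : ∀ p → p ℚ.≤ ℚ.∣ p ∣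
  p≤∣p∣ p with ℚ.≤-total 0ℚ p
  ... | inj₁ 0≤p = ℚ.≤-reflexive (sym (ℚ.0≤p⇒∣p∣≡p 0≤p))
  ... | inj₂ p≤0 = ℚ.≤-trans p≤0 (ℚ.0≤∣p∣ p)

  -- A Cauchy sequence is eventually bounded in absolute value.
  bounded : (x : ℝ) → ∃[ K ] K ℚ.> 0ℚ ×
            ∃[ N ] (∀ n → n ℕ.≥ N → ℚ.∣ seq x n ∣ ℚ.≤ K)
  bounded (mkℝ x c) with c 1ℚ (ℚ.positive⁻¹ 1ℚ)
  ... | N , close = ℚ.∣ x N ∣ ℚ.+ 1ℚ
                  , ℚ.+-mono-≤-< (ℚ.0≤∣p∣ (x N)) (ℚ.positive⁻¹ 1ℚ)
                  , N , λ n n≥N → begin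
      ℚ.∣ x n ∣
        ≡⟨ cong ℚ.∣_∣ (solve 2 (λ a b → a := b :+ (a :- b)) refl (x n) (x N)) ⟩
      ℚ.∣ x N ℚ.+ (x n ℚ.- x N) ∣
        ≤⟨ ℚ.∣p+q∣≤∣p∣+∣q∣ (x N) (x n ℚ.- x N) ⟩
      ℚ.∣ x N ∣ ℚ.+ ℚ.∣ x n ℚ.- x N ∣
        ≤⟨ ℚ.+-monoʳ-≤ ℚ.∣ x N ∣ (ℚ.<⇒≤ (close n N n≥N ℕ.≤-refl)) ⟩
      ℚ.∣ x N ∣ ℚ.+ 1ℚ ∎
    where open ℚ.≤-Reasoning

  -- For every K > 0 and ε > 0 there is η > 0 with K η = ε.
  shrink : ∀ {K ε} → K ℚ.> 0ℚ → ε ℚ.> 0ℚ → ∃[ η ] η ℚ.> 0ℚ × K ℚ.* η ≡ ε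
  shrink {K} {ε} K>0 ε>0 = η , η>0 , eq
    where
    instance
      K-pos : Positive K
      K-pos = ℚ.positive K>0
      K≢0 : ℚ.NonZero K
      K≢0 = ℚ.pos⇒nonZero K
      1/K-pos : Positive (ℚ.1/ K)
      1/K-pos = ℚ.1/pos⇒pos K
    η = ℚ.1/ K ℚ.* ε
    η>0 : η ℚ.> 0ℚ
    η>0 = ℚ.positive⁻¹ η {{ℚ.pos*pos⇒pos (ℚ.1/ K) ε {{ℚ.positive ε>0}}}}
    eq : K ℚ.* η ≡ ε
    eq = trans (sym (ℚ.*-assoc K (ℚ.1/ K) ε))
        (trans (cong (ℚ._* ε) (ℚ.*-inverseʳ K)) (ℚ.*-identityˡ ε))

  scaled : ∀ {K η p q ε} → K ℚ.* η ≡ ε → ℚ.∣ p ∣ ℚ.≤ K → ℚ.∣ q ∣ ℚ.< η → K ℚ.> 0ℚ →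
           ℚ.∣ p ℚ.* q ∣ ℚ.< ε
  scaled {K} {η} {p} {q} {ε} Kη p≤K q<η K>0 = begin-strict
    ℚ.∣ p ℚ.* q ∣           ≡⟨ ℚ.∣p*q∣≡∣p∣*∣q∣ p q ⟩
    ℚ.∣ p ∣ ℚ.* ℚ.∣ q ∣     ≤⟨ ℚ.*-monoʳ-≤-nonNeg ℚ.∣ q ∣ {{ℚ.nonNegative (ℚ.0≤∣p∣ q)}} p≤K ⟩
    K ℚ.* ℚ.∣ q ∣           <⟨ ℚ.*-monoʳ-<-pos K {{ℚ.positive K>0}} q<η ⟩
    K ℚ.* η                 ≡⟨ Kη ⟩
    ε                       ∎
    where open ℚ.≤-Reasoning

  sum-close : ∀ {p q p′ q′ ε} → ℚ.∣ p ℚ.- p′ ∣ ℚ.< ½ ℚ.* ε → ℚ.∣ q ℚ.- q′ ∣ ℚ.< ½ ℚ.* ε →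
              ℚ.∣ (p ℚ.+ q) ℚ.- (p′ ℚ.+ q′) ∣ ℚ.< ε
  sum-close {p} {q} {p′} {q′} {ε} hp hq = begin-strict
    ℚ.∣ (p ℚ.+ q) ℚ.- (p′ ℚ.+ q′) ∣           ≡⟨ cong ℚ.∣_∣ (solve 4 (λ a b a′ b′ →
                                                   (a :+ b) :- (a′ :+ b′) := (a :- a′) :+ (b :- b′))
                                                   refl p q p′ q′) ⟩
    ℚ.∣ (p ℚ.- p′) ℚ.+ (q ℚ.- q′) ∣           ≤⟨ ℚ.∣p+q∣≤∣p∣+∣q∣ (p ℚ.- p′) (q ℚ.- q′) ⟩
    ℚ.∣ p ℚ.- p′ ∣ ℚ.+ ℚ.∣ q ℚ.- q′ ∣         <⟨ ℚ.+-mono-< hp hq ⟩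
    ½ ℚ.* ε ℚ.+ ½ ℚ.* ε                       ≡⟨ halves ε ⟩
    ε                                         ∎
    where open ℚ.≤-Reasoning

  product-close : ∀ {p q p′ q′ ε} → ℚ.∣ p ℚ.* (q ℚ.- q′) ∣ ℚ.< ½ ℚ.* ε →
                  ℚ.∣ q′ ℚ.* (p ℚ.- p′) ∣ ℚ.< ½ ℚ.* ε →
                  ℚ.∣ p ℚ.* q ℚ.- p′ ℚ.* q′ ∣ ℚ.< ε
  product-close {p} {q} {p′} {q′} {ε} hp hq = begin-strict
    ℚ.∣ p ℚ.* q ℚ.- p′ ℚ.* q′ ∣                            ≡⟨ cong ℚ.∣_∣ (solve 4 (λ a b a′ b′ →
                                                                a :* b :- a′ :* b′ := a :* (b :- b′) :+ b′ :* (a :- a′))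
                                                                refl p q p′ q′) ⟩
    ℚ.∣ p ℚ.* (q ℚ.- q′) ℚ.+ q′ ℚ.* (p ℚ.- p′) ∣           ≤⟨ ℚ.∣p+q∣≤∣p∣+∣q∣ (p ℚ.* (q ℚ.- q′)) (q′ ℚ.* (p ℚ.- p′)) ⟩
    ℚ.∣ p ℚ.* (q ℚ.- q′) ∣ ℚ.+ ℚ.∣ q′ ℚ.* (p ℚ.- p′) ∣     <⟨ ℚ.+-mono-< hp hq ⟩
    ½ ℚ.* ε ℚ.+ ½ ℚ.* ε                                    ≡⟨ halves ε ⟩
    ε                                                      ∎
    where open ℚ.≤-Reasoning

_+ᴿ_ : ℝ → ℝ → ℝ
x +ᴿ y = mkℝ (λ n → seq x n ℚ.+ seq y n) c
  where
  c : Cauchy (λ n → seq x n ℚ.+ seq y n)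
  c ε ε>0 =
    let M , cx = cauchy x (½ ℚ.* ε) (half>0 ε>0)
        N , cy = cauchy y (½ ℚ.* ε) (half>0 ε>0)
    in M ℕ.⊔ N , λ m n m≥ n≥ → sum-close {p = seq x m} {q = seq y m}
         (cx m n (ℕ.m⊔n≤o⇒m≤o M N m≥) (ℕ.m⊔n≤o⇒m≤o M N n≥))
         (cy m n (ℕ.m⊔n≤o⇒n≤o M N m≥) (ℕ.m⊔n≤o⇒n≤o M N n≥))

_*ᴿ_ : ℝ → ℝ → ℝ
x *ᴿ y = mkℝ (λ n → seq x n ℚ.* seq y n) c
  where
  c : Cauchy (λ n → seq x n ℚ.* seq y n)
  c ε ε>0 =
    let K , K>0 , A , bx = bounded x
        L , L>0 , B , by = bounded y
        η , η>0 , Kη     = shrink K>0 (half>0 ε>0)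
        θ , θ>0 , Lθ     = shrink L>0 (half>0 ε>0)
        M , cy           = cauchy y η η>0
        N , cx           = cauchy x θ θ>0
        AM               = A ℕ.⊔ M
        BN               = B ℕ.⊔ N
    in AM ℕ.⊔ BN , λ m n m≥ n≥ →
      let m≥AM = ℕ.m⊔n≤o⇒m≤o AM BN m≥
          m≥BN = ℕ.m⊔n≤o⇒n≤o AM BN m≥
          n≥AM = ℕ.m⊔n≤o⇒m≤o AM BN n≥
          n≥BN = ℕ.m⊔n≤o⇒n≤o AM BN n≥
      in product-close {p = seq x m} {q = seq y m}
           (scaled {p = seq x m} Kη (bx m (ℕ.m⊔n≤o⇒m≤o A M m≥AM))
             (cy m n (ℕ.m⊔n≤o⇒n≤o A M m≥AM) (ℕ.m⊔n≤o⇒n≤o A M n≥AM)) K>0)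
           (scaled {p = seq y n} Lθ (by n (ℕ.m⊔n≤o⇒m≤o B N n≥BN))
             (cx m n (ℕ.m⊔n≤o⇒n≤o B N m≥BN) (ℕ.m⊔n≤o⇒n≤o B N n≥BN)) L>0)

_/ᴿ_ : ℝ → (d : ℕ) .{{_ : NonZero d}} → ℝ
x /ᴿ d = x *ᴿ fromℚ (+ 1 ℚ./ d)

------------------------------------------------------------------------
-- The natural logarithm at positive integers

-- 1/(a+1) + 1/(a+2) + ⋯ + 1/(a+c)
reciprocals : ℕ → ℕ → ℚ
reciprocals a zero    = 0ℚ
reciprocals a (suc c) = reciprocals a c ℚ.+ (+ 1 ℚ./ suc (a ℕ.+ c))

-- ln m = ∫₁ᵐ dt/t.  With mesh 1/N the right Riemann sum of this integral is
--   Σ_{i=1}^{(m-1)N} (1/N) · 1/(1 + i/N)  =  Σ_{i=1}^{(m-1)N} 1/(N+i);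
-- the sequence is indexed from 0, hence N = suc j.
lnSeq : (m : ℕ) .{{_ : NonZero m}} → ℕ → ℚ
lnSeq m j = reciprocals (suc j) (ℕ.pred m ℕ.* suc j)

module Reciprocals where
  recip : ℕ → ℚ
  recip d = + 1 ℚ./ suc d

  recipᵘ : ∀ d → toℚᵘ (recip d) ℚᵘ.≃ ℚᵘ.mkℚᵘ (+ 1) d
  recipᵘ d = ℚ.toℚᵘ-fromℚᵘ (ℚᵘ.mkℚᵘ (+ 1) d)

  intᵘ : ∀ n → toℚᵘ (+ n ℚ./ 1) ℚᵘ.≃ ℚᵘ.mkℚᵘ (+ n) 0
  intᵘ n = ℚ.toℚᵘ-fromℚᵘ (ℚᵘ.mkℚᵘ (+ n) 0)

  recip-anti : ∀ {d e} → d ℕ.≤ e → recip e ℚ.≤ recip d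
  recip-anti {d} {e} d≤e = ℚ.toℚᵘ-cancel-≤
    (ℚᵘ.≤-respˡ-≃ (ℚᵘ.≃-sym (recipᵘ e)) (ℚᵘ.≤-respʳ-≃ (ℚᵘ.≃-sym (recipᵘ d))
      (ℚᵘ.*≤* (subst₂ ℤ._≤_ (sym (ℤ.*-identityˡ (+ suc d))) (sym (ℤ.*-identityˡ (+ suc e)))
        (ℤ.+≤+ (ℕ.s≤s d≤e))))))

  recip>0 : ∀ d → recip d ℚ.> 0ℚ
  recip>0 d = ℚ.toℚᵘ-cancel-<
    (ℚᵘ.<-respʳ-≃ (ℚᵘ.≃-sym (recipᵘ d)) (ℚᵘ.positive⁻¹ (ℚᵘ.mkℚᵘ (+ 1) d)))

  -- Archimedean property
  recip-small : ∀ ε → ε ℚ.> 0ℚ → ∃[ N ] recip N ℚ.< ε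
  recip-small ε@(mkℚ (+ suc p) d _) ε>0 = suc d , ℚ.toℚᵘ-cancel-<
    (ℚᵘ.<-respˡ-≃ (ℚᵘ.≃-sym (recipᵘ (suc d))) (ℚᵘ.*<* (ℤ.+<+ (begin-strict
      1 ℕ.* suc d             ≡⟨ ℕ.*-identityˡ (suc d) ⟩
      suc d                   <⟨ ℕ.n<1+n (suc d) ⟩
      suc (suc d)             ≤⟨ ℕ.m≤m+n (suc (suc d)) (p ℕ.* suc (suc d)) ⟩
      suc p ℕ.* suc (suc d)   ∎))))
    where open ℕ.≤-Reasoning
  recip-small (mkℚ (+ zero)     d _) (ℚ.*<* (ℤ.+<+ ()))
  recip-small (mkℚ ℤ.-[1+ p ]  d _) (ℚ.*<* ())

  int-suc : ∀ n → + suc n ℚ./ 1 ≡ (+ n ℚ./ 1) ℚ.+ 1ℚ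
  int-suc n = ℚ.toℚᵘ-injective (begin
    toℚᵘ (+ suc n ℚ./ 1)                ≈⟨ intᵘ (suc n) ⟩
    ℚᵘ.mkℚᵘ (+ suc n) 0                 ≈⟨ ℚᵘ.*≡* (cong (ℤ._* + 1) (sym lemma)) ⟩
    ℚᵘ.mkℚᵘ (+ n) 0 ℚᵘ.+ ℚᵘ.1ℚᵘ         ≈⟨ ℚᵘ.+-congˡ ℚᵘ.1ℚᵘ (ℚᵘ.≃-sym (intᵘ n)) ⟩
    toℚᵘ (+ n ℚ./ 1) ℚᵘ.+ toℚᵘ 1ℚ       ≈⟨ ℚᵘ.≃-sym (ℚ.toℚᵘ-homo-+ (+ n ℚ./ 1) 1ℚ) ⟩
    toℚᵘ ((+ n ℚ./ 1) ℚ.+ 1ℚ)           ∎)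
    where
    open ℚᵘ.≃-Reasoning
    lemma : + n ℤ.* + 1 ℤ.+ + 1 ℤ.* + 1 ≡ + suc n
    lemma = trans (cong (ℤ._+ + 1) (ℤ.*-identityʳ (+ n))) (cong +_ (ℕ.+-comm n 1))

  -- L · 1/(L d) = 1/d, with predecessors as arguments
  int*recip : ∀ l d → (+ suc l ℚ./ 1) ℚ.* recip (d ℕ.+ l ℕ.* suc d) ≡ recip d
  int*recip l d = ℚ.toℚᵘ-injective (begin
    toℚᵘ ((+ suc l ℚ./ 1) ℚ.* recip e)           ≈⟨ ℚ.toℚᵘ-homo-* (+ suc l ℚ./ 1) (recip e) ⟩
    toℚᵘ (+ suc l ℚ./ 1) ℚᵘ.* toℚᵘ (recip e)     ≈⟨ ℚᵘ.*-cong (intᵘ (suc l)) (recipᵘ e) ⟩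
    ℚᵘ.mkℚᵘ (+ suc l) 0 ℚᵘ.* ℚᵘ.mkℚᵘ (+ 1) e     ≈⟨ ℚᵘ.*≡* lemma ⟩
    ℚᵘ.mkℚᵘ (+ 1) d                              ≈⟨ ℚᵘ.≃-sym (recipᵘ d) ⟩
    toℚᵘ (recip d)                               ∎)
    where
    open ℚᵘ.≃-Reasoning
    e = d ℕ.+ l ℕ.* suc d
    lemma : (+ suc l ℤ.* + 1) ℤ.* + suc d ≡ + 1 ℤ.* + (1 ℕ.* suc e)
    lemma = trans (cong (ℤ._* + suc d) (ℤ.*-identityʳ (+ suc l)))
           (trans (sym (ℤ.pos-* (suc l) (suc d)))
           (trans (cong +_ (sym (ℕ.*-identityˡ (suc e))))
                  (sym (ℤ.*-identityˡ (+ (1 ℕ.* suc e))))))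

  ≤-sum : ∀ q a c → (∀ i → i ℕ.< c → q ℚ.≤ recip (a ℕ.+ i)) →
          (+ c ℚ./ 1) ℚ.* q ℚ.≤ reciprocals a c
  ≤-sum q a zero    h = ℚ.≤-reflexive (ℚ.*-zeroˡ q)
  ≤-sum q a (suc c) h = begin
    (+ suc c ℚ./ 1) ℚ.* q               ≡⟨ cong (ℚ._* q) (int-suc c) ⟩
    ((+ c ℚ./ 1) ℚ.+ 1ℚ) ℚ.* q          ≡⟨ ℚ.*-distribʳ-+ q (+ c ℚ./ 1) 1ℚ ⟩
    (+ c ℚ./ 1) ℚ.* q ℚ.+ 1ℚ ℚ.* q      ≡⟨ cong (((+ c ℚ./ 1) ℚ.* q) ℚ.+_) (ℚ.*-identityˡ q) ⟩
    (+ c ℚ./ 1) ℚ.* q ℚ.+ q             ≤⟨ ℚ.+-mono-≤ (≤-sum q a c (λ i i<c → h i (ℕ.m<n⇒m<1+n i<c)))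
                                                      (h c (ℕ.n<1+n c)) ⟩
    reciprocals a c ℚ.+ recip (a ℕ.+ c) ∎
    where open ℚ.≤-Reasoning

  sum-≤ : ∀ q a c → (∀ i → i ℕ.< c → recip (a ℕ.+ i) ℚ.≤ q) →
          reciprocals a c ℚ.≤ (+ c ℚ./ 1) ℚ.* q
  sum-≤ q a zero    h = ℚ.≤-reflexive (sym (ℚ.*-zeroˡ q))
  sum-≤ q a (suc c) h = begin
    reciprocals a c ℚ.+ recip (a ℕ.+ c) ≤⟨ ℚ.+-mono-≤ (sum-≤ q a c (λ i i<c → h i (ℕ.m<n⇒m<1+n i<c)))
                                                      (h c (ℕ.n<1+n c)) ⟩
    (+ c ℚ./ 1) ℚ.* q ℚ.+ q             ≡⟨ cong (((+ c ℚ./ 1) ℚ.* q) ℚ.+_) (sym (ℚ.*-identityˡ q)) ⟩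
    (+ c ℚ./ 1) ℚ.* q ℚ.+ 1ℚ ℚ.* q      ≡⟨ sym (ℚ.*-distribʳ-+ q (+ c ℚ./ 1) 1ℚ) ⟩
    ((+ c ℚ./ 1) ℚ.+ 1ℚ) ℚ.* q          ≡⟨ cong (ℚ._* q) (sym (int-suc c)) ⟩
    (+ suc c ℚ./ 1) ℚ.* q               ∎
    where open ℚ.≤-Reasoning

  split : ∀ a c d → reciprocals a (c ℕ.+ d) ≡ reciprocals a c ℚ.+ reciprocals (a ℕ.+ c) d
  split a c zero    = trans (cong (reciprocals a) (ℕ.+-identityʳ c))
                            (sym (ℚ.+-identityʳ (reciprocals a c)))
  split a c (suc d) = trans (cong (reciprocals a) (ℕ.+-suc c d))
    (trans (cong₂ ℚ._+_ (split a c d) (cong recip (sym (ℕ.+-assoc a c d))))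
           (ℚ.+-assoc (reciprocals a c) (reciprocals (a ℕ.+ c) d) (recip (a ℕ.+ c ℕ.+ d))))

  -- One block of length L = suc l:
  -- 1/(a+1) ≤ Σ_{i=1}^{L} 1/(L a + i) ≤ 1/a
  block-≥ : ∀ l a → recip a ℚ.≤ reciprocals (suc l ℕ.* a) (suc l)
  block-≥ l a = subst (ℚ._≤ reciprocals (suc l ℕ.* a) (suc l)) (int*recip l a)
    (≤-sum (recip (a ℕ.+ l ℕ.* suc a)) (suc l ℕ.* a) (suc l) λ i i<L → recip-anti (begin
      suc l ℕ.* a ℕ.+ i        ≤⟨ ℕ.+-monoʳ-≤ (suc l ℕ.* a) (ℕ.s≤s⁻¹ i<L) ⟩
      a ℕ.+ l ℕ.* a ℕ.+ l      ≡⟨ ℕ.+-assoc a (l ℕ.* a) l ⟩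
      a ℕ.+ (l ℕ.* a ℕ.+ l)    ≡⟨ cong (a ℕ.+_) (ℕ.+-comm (l ℕ.* a) l) ⟩
      a ℕ.+ (l ℕ.+ l ℕ.* a)    ≡⟨ cong (a ℕ.+_) (sym (ℕ.*-suc l a)) ⟩
      a ℕ.+ l ℕ.* suc a        ∎))
    where open ℕ.≤-Reasoning

  block-≤ : ∀ l a → reciprocals (suc l ℕ.* suc a) (suc l) ℚ.≤ recip a
  block-≤ l a = subst (reciprocals (suc l ℕ.* suc a) (suc l) ℚ.≤_) (int*recip l a)
    (sum-≤ (recip (a ℕ.+ l ℕ.* suc a)) (suc l ℕ.* suc a) (suc l) λ i _ → recip-anti (begin
      a ℕ.+ l ℕ.* suc a          ≤⟨ ℕ.n≤1+n _ ⟩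
      suc l ℕ.* suc a            ≤⟨ ℕ.m≤m+n _ i ⟩
      suc l ℕ.* suc a ℕ.+ i      ∎))
    where open ℕ.≤-Reasoning

  snoc-block : ∀ l a c → reciprocals (suc l ℕ.* a) (suc l ℕ.* suc c) ≡
    reciprocals (suc l ℕ.* a) (suc l ℕ.* c) ℚ.+ reciprocals (suc l ℕ.* (a ℕ.+ c)) (suc l)
  snoc-block l a c = begin
    reciprocals La (suc l ℕ.* suc c)
      ≡⟨ cong (reciprocals La) (trans (ℕ.*-suc (suc l) c) (ℕ.+-comm (suc l) Lc)) ⟩
    reciprocals La (Lc ℕ.+ suc l)
      ≡⟨ split La Lc (suc l) ⟩
    reciprocals La Lc ℚ.+ reciprocals (La ℕ.+ Lc) (suc l)
      ≡⟨ cong (λ z → reciprocals La Lc ℚ.+ reciprocals z (suc l))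
              (sym (ℕ.*-distribˡ-+ (suc l) a c)) ⟩
    reciprocals La Lc ℚ.+ reciprocals (suc l ℕ.* (a ℕ.+ c)) (suc l) ∎
    where
    open ≡-Reasoning
    La = suc l ℕ.* a
    Lc = suc l ℕ.* c

  refine-≥ : ∀ l a c → reciprocals a c ℚ.≤ reciprocals (suc l ℕ.* a) (suc l ℕ.* c)
  refine-≥ l a zero    = ℚ.≤-reflexive (cong (reciprocals (suc l ℕ.* a)) (sym (ℕ.*-zeroʳ (suc l))))
  refine-≥ l a (suc c) = ℚ.≤-trans (ℚ.+-mono-≤ (refine-≥ l a c) (block-≥ l (a ℕ.+ c)))
                                   (ℚ.≤-reflexive (sym (snoc-block l a c)))

  refine-≤ : ∀ l a c → reciprocals (suc l ℕ.* suc a) (suc l ℕ.* c) ℚ.≤ reciprocals a c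
  refine-≤ l a zero    = ℚ.≤-reflexive (cong (reciprocals (suc l ℕ.* suc a)) (ℕ.*-zeroʳ (suc l)))
  refine-≤ l a (suc c) = ℚ.≤-trans (ℚ.≤-reflexive (snoc-block l (suc a) c))
                                   (ℚ.+-mono-≤ (refine-≤ l a c) (block-≤ l (a ℕ.+ c)))

  shift : ∀ a c → reciprocals a c ℚ.≤ reciprocals (suc a) c ℚ.+ recip a
  shift a c = begin
    reciprocals a c                             ≡⟨ ℚ.+-identityʳ _ ⟨
    reciprocals a c ℚ.+ 0ℚ                      ≤⟨ ℚ.+-monoʳ-≤ (reciprocals a c) (ℚ.<⇒≤ (recip>0 (a ℕ.+ c))) ⟩
    reciprocals a (1 ℕ.+ c)                     ≡⟨ split a 1 c ⟩
    reciprocals a 1 ℚ.+ reciprocals (a ℕ.+ 1) c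
      ≡⟨ cong₂ (λ p q → p ℚ.+ reciprocals q c)
               (trans (ℚ.+-identityˡ (recip (a ℕ.+ 0))) (cong recip (ℕ.+-identityʳ a)))
               (ℕ.+-comm a 1) ⟩
    recip a ℚ.+ reciprocals (suc a) c           ≡⟨ ℚ.+-comm (recip a) (reciprocals (suc a) c) ⟩
    reciprocals (suc a) c ℚ.+ recip a           ∎
    where open ℚ.≤-Reasoning

  -- Both sums are compared with the one of mesh 1/((i+1)(j+1)).
  compare : ∀ m .{{_ : NonZero m}} i j → lnSeq m i ℚ.≤ lnSeq m j ℚ.+ recip j
  compare m i j = begin
    reciprocals (suc i) (k ℕ.* suc i)
      ≤⟨ refine-≥ j (suc i) (k ℕ.* suc i) ⟩
    reciprocals (suc j ℕ.* suc i) (suc j ℕ.* (k ℕ.* suc i))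
      ≡⟨ cong₂ reciprocals (ℕ.*-comm (suc j) (suc i)) swap ⟩
    reciprocals (suc i ℕ.* suc j) (suc i ℕ.* (k ℕ.* suc j))
      ≤⟨ refine-≤ i j (k ℕ.* suc j) ⟩
    reciprocals j (k ℕ.* suc j)
      ≤⟨ shift j (k ℕ.* suc j) ⟩
    reciprocals (suc j) (k ℕ.* suc j) ℚ.+ recip j ∎
    where
    open ℚ.≤-Reasoning
    k = ℕ.pred m
    swap : suc j ℕ.* (k ℕ.* suc i) ≡ suc i ℕ.* (k ℕ.* suc j)
    swap = trans (ℕ.*-comm (suc j) (k ℕ.* suc i))
          (trans (cong (ℕ._* suc j) (ℕ.*-comm k (suc i)))
                 (ℕ.*-assoc (suc i) k (suc j)))

  ∣-∣≤ : ∀ {p q r} → p ℚ.≤ q ℚ.+ r → q ℚ.≤ p ℚ.+ r → ℚ.∣ p ℚ.- q ∣ ℚ.≤ r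
  ∣-∣≤ {p} {q} {r} p≤ q≤ with ℚ.∣p∣≡p∨∣p∣≡-p (p ℚ.- q)
  ... | inj₁ eq = begin
      ℚ.∣ p ℚ.- q ∣             ≡⟨ eq ⟩
      p ℚ.- q                   ≤⟨ ℚ.+-monoˡ-≤ (ℚ.- q) p≤ ⟩
      q ℚ.+ r ℚ.- q             ≡⟨ solve 2 (λ a b → a :+ b :- a := b) refl q r ⟩
      r                         ∎
    where open ℚ.≤-Reasoning
  ... | inj₂ eq = begin
      ℚ.∣ p ℚ.- q ∣             ≡⟨ eq ⟩
      ℚ.- (p ℚ.- q)             ≡⟨ solve 2 (λ a b → :- (a :- b) := b :- a) refl p q ⟩
      q ℚ.- p                   ≤⟨ ℚ.+-monoˡ-≤ (ℚ.- p) q≤ ⟩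
      p ℚ.+ r ℚ.- p             ≡⟨ solve 2 (λ a b → a :+ b :- a := b) refl p r ⟩
      r                         ∎
    where open ℚ.≤-Reasoning

open Reciprocals

lnSeq-cauchy : (m : ℕ) .{{_ : NonZero m}} → Cauchy (lnSeq m)
lnSeq-cauchy m ε ε>0 with recip-small ε ε>0
... | N , 1/N<ε = N , λ i j i≥N j≥N → ℚ.≤-<-trans
  (∣-∣≤ (ℚ.≤-trans (compare m i j) (ℚ.+-monoʳ-≤ (lnSeq m j) (recip-anti j≥N)))
        (ℚ.≤-trans (compare m j i) (ℚ.+-monoʳ-≤ (lnSeq m i) (recip-anti i≥N))))
  1/N<ε

ln : (m : ℕ) .{{_ : NonZero m}} → ℝ
ln m = mkℝ (lnSeq m) (lnSeq-cauchy m)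

------------------------------------------------------------------------
-- Graphs

record Graph (n : ℕ) : Set₁ where
  field
    _~_   : Rel (Fin n) 0ℓ
    _~?_  : Decidable _~_
    ~-sym : Symmetric _~_
    ~-irr : Irreflexive _≡_ _~_

module _ {n : ℕ} (G : Graph n) where
  open Graph G

  neighbours : Fin n → Subset n
  neighbours v = tabulate (λ u → does (v ~? u))

  degree : Fin n → ℕ
  degree v = ∣ neighbours v ∣

  IsMinDegree : ℕ → Set
  IsMinDegree δ = (∃[ v ] degree v ≡ δ) × (∀ v → δ ℕ.≤ degree v)

  -- A set of edges, given as a symmetric relation; two of its edges sharing
  -- an end v are equal.
  record Matching : Set₁ where
    field
      _—_      : Rel (Fin n) 0ℓ
      —⇒~      : ∀ {u v} → u — v → u ~ v
      —-sym    : Symmetric _—_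
      —-unique : ∀ {u v w} → v — u → v — w → u ≡ w

    Covers : Fin n → Set
    Covers v = ∃[ u ] v — u

  IsPerfect : Matching → Set
  IsPerfect M =
      (n ℕ.% 2 ≡ 0 → ∀ v → Covers v)
    × (n ℕ.% 2 ≡ 1 → ∃[ u ] (¬ Covers u) × (∀ v → v ≢ u → Covers v))
    where open Matching M

  HasPerfectMatching : Set₁
  HasPerfectMatching = ∃[ M ] IsPerfect M

  IsDominating : Subset n → Set
  IsDominating X = ∀ v → v ∉ X → ∃[ u ] u ∈ X × v ~ u

  IsRestrainedDominating : Subset n → Set
  IsRestrainedDominating X =
    IsDominating X × (∀ v → v ∉ X → ∃[ u ] u ∉ X × v ~ u)

  IsTotalRestrainedDominating : Subset n → Set
  IsTotalRestrainedDominating X =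
    IsRestrainedDominating X × (∀ v → v ∈ X → ∃[ u ] u ∈ X × v ~ u)

IsMinCardinality : ∀ {n} → (Subset n → Set) → ℕ → Set
IsMinCardinality P k = (∃[ X ] P X × ∣ X ∣ ≡ k) × (∀ X → P X → k ℕ.≤ ∣ X ∣)

-- γ_r(G) = k
IsRestrainedDominationNumber : ∀ {n} → Graph n → ℕ → Set
IsRestrainedDominationNumber G = IsMinCardinality (IsRestrainedDominating G)

-- γ_tr(G) = k
IsTotalRestrainedDominationNumber : ∀ {n} → Graph n → ℕ → Set
IsTotalRestrainedDominationNumber G = IsMinCardinality (IsTotalRestrainedDominating G)

-- A greedy choice of vertices covers V(G) by s neighbourhoods, each of size at
-- least d (closed ones, d = δ + 1, for γ_r; open ones, d = δ, for γ_tr).  If u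
-- vertices are uncovered, double counting gives a vertex covering r of them with
-- n r ≥ d u.  Charging min(1, n/i) for the i-th of the d u units of uncovered
-- mass, each greedy step pays at least d, whence d s ≤ n (1 + Σ_{n<i≤dn} 1/i),
-- and this sum is a term of the sequence defining ln d.  Closing the chosen
-- vertices under the matching and adding the uncovered vertex, if any, leaves a
-- union of matching edges as the complement.
module Submission where

open import Defs
open import Data.Nat using (ℕ; suc; _*_; _%_; NonZero)
open import Data.Product using (_×_)

import Algebra.Properties.CommutativeSemigroup as CommSemigroup
import Algebra.Properties.Semiring.Sum as Sum
open import Data.Bool using (true; false; if_then_else_; _∧_)
open import Data.Fin using (Fin; zero; suc)
open import Data.Fin.Subset
  using (Subset; _∈_; _∉_; _∪_; _∩_; _─_; ∣_∣; ⊤; ⊥; ⁅_⁆; inside; outside)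
open import Data.Fin.Subset.Properties
open import Data.Integer as ℤ using (+_)
import Data.Integer.Properties as ℤ
open import Data.List using (List; []; _∷_; length)
import Data.List.Membership.Propositional as List
open import Data.List.Relation.Unary.Any using (here; there)
open import Data.Nat as ℕ using (zero; _≤_; _<_; z≤n; s≤s)
import Data.Nat.DivMod as ℕ
import Data.Nat.Properties as ℕ
open import Data.Product using (∃-syntax; _,_; proj₂)
open import Data.Rational as ℚ using (ℚ; 0ℚ; 1ℚ)
import Data.Rational.Properties as ℚ
open import Data.Rational.Solver using (module +-*-Solver)
import Data.Rational.Unnormalised as ℚᵘ
import Data.Rational.Unnormalised.Properties as ℚᵘ
open import Data.Sum using (inj₁; inj₂)
open import Data.Vec using ([]; _∷_)
open import Data.Vec.Properties using (lookup∘tabulate; lookup⇒[]=; []=⇒lookup)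
open import Function using (_∘_; mk⇔; case_of_)
open import Relation.Binary.PropositionalEquality
open import Relation.Nullary using (yes; no; does; invert; proof; contradiction; Reflects; _×-dec_)
open import Relation.Nullary.Decidable using (does-⇔; dec-true)

open +-*-Solver using (solve; con; _:+_; _:*_; _:=_)
open Reciprocals
open Sum ℕ.+-*-semiring using (sum; sum-cong-≗; *-distribˡ-sum; ∑-comm)

-- Natural numbers as rationals, and the potential of the greedy charging.

module _ where
  open import Data.Rational using (_+_)

  ⟦_⟧ : ℕ → ℚ
  ⟦ n ⟧ = + n ℚ./ 1

  ⟦⟧-mono : ∀ {m n} → m ≤ n → ⟦ m ⟧ ℚ.≤ ⟦ n ⟧
  ⟦⟧-mono {m} {n} m≤n = ℚ.toℚᵘ-cancel-≤
    (ℚᵘ.≤-respˡ-≃ (ℚᵘ.≃-sym (intᵘ m)) (ℚᵘ.≤-respʳ-≃ (ℚᵘ.≃-sym (intᵘ n))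
      (ℚᵘ.*≤* (ℤ.*-monoʳ-≤-nonNeg (+ 1) (ℤ.+≤+ m≤n)))))

  ⟦⟧-+ : ∀ m n → ⟦ m ℕ.+ n ⟧ ≡ ⟦ m ⟧ + ⟦ n ⟧
  ⟦⟧-+ zero    n = sym (ℚ.+-identityˡ ⟦ n ⟧)
  ⟦⟧-+ (suc m) n = begin
    ⟦ suc (m ℕ.+ n) ⟧      ≡⟨ int-suc (m ℕ.+ n) ⟩
    ⟦ m ℕ.+ n ⟧ + 1ℚ       ≡⟨ cong (_+ 1ℚ) (⟦⟧-+ m n) ⟩
    ⟦ m ⟧ + ⟦ n ⟧ + 1ℚ     ≡⟨ solve 3 (λ a b c → a :+ b :+ c := a :+ c :+ b) refl ⟦ m ⟧ ⟦ n ⟧ 1ℚ ⟩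
    ⟦ m ⟧ + 1ℚ + ⟦ n ⟧     ≡⟨ cong (_+ ⟦ n ⟧) (int-suc m) ⟨
    ⟦ suc m ⟧ + ⟦ n ⟧      ∎
    where
    open ≡-Reasoning

  ⟦⟧-* : ∀ m n → ⟦ m * n ⟧ ≡ ⟦ m ⟧ ℚ.* ⟦ n ⟧
  ⟦⟧-* zero    n = sym (ℚ.*-zeroˡ ⟦ n ⟧)
  ⟦⟧-* (suc m) n = begin
    ⟦ n ℕ.+ m * n ⟧                ≡⟨ ⟦⟧-+ n (m * n) ⟩
    ⟦ n ⟧ + ⟦ m * n ⟧              ≡⟨ cong (⟦ n ⟧ ℚ.+_) (⟦⟧-* m n) ⟩
    ⟦ n ⟧ + ⟦ m ⟧ ℚ.* ⟦ n ⟧        ≡⟨ solve 2 (λ a b → b :+ a :* b := (a :+ con 1ℚ) :* b) refl ⟦ m ⟧ ⟦ n ⟧ ⟩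
    (⟦ m ⟧ + 1ℚ) ℚ.* ⟦ n ⟧         ≡⟨ cong (ℚ._* ⟦ n ⟧) (int-suc m) ⟨
    ⟦ suc m ⟧ ℚ.* ⟦ n ⟧            ∎
    where
    open ≡-Reasoning

  ⟦⟧-nonNeg : ∀ n → ℚ.NonNegative ⟦ n ⟧
  ⟦⟧-nonNeg n = ℚ.nonNegative (⟦⟧-mono {0} {n} z≤n)

  recip-nonNeg : ∀ d → ℚ.NonNegative (recip d)
  recip-nonNeg d = ℚ.nonNegative (ℚ.<⇒≤ (recip>0 d))

  ⟦suc⟧*recip : ∀ d → ⟦ suc d ⟧ ℚ.* recip d ≡ 1ℚ
  ⟦suc⟧*recip d = trans (cong (λ e → ⟦ suc d ⟧ ℚ.* recip e) (sym (ℕ.*-identityʳ d)))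
                        (int*recip d 0)

  -- The weight min(1, n/(i+1)) of unit number i + 1.
  weight : ℕ → ℕ → ℚ
  weight n i = 1ℚ ℚ.⊓ (⟦ n ⟧ ℚ.* recip i)

  -- Evaluated below at `suc d * ∣ U ∣`, each uncovered vertex standing for `suc d` units.
  potential : ℕ → ℕ → ℚ
  potential n zero    = 0ℚ
  potential n (suc m) = potential n m + weight n m

  weight-anti : ∀ n {i j} → i ≤ j → weight n j ℚ.≤ weight n i
  weight-anti n i≤j = ℚ.⊓-monoʳ-≤ 1ℚ
    (ℚ.*-monoˡ-≤-nonNeg ⟦ n ⟧ {{⟦⟧-nonNeg n}} (recip-anti i≤j))

  potential-≤ : ∀ n m → potential n m ℚ.≤ ⟦ m ⟧
  potential-≤ n zero    = ℚ.≤-refl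
  potential-≤ n (suc m) = subst (potential n (suc m) ℚ.≤_) (sym (int-suc m))
    (ℚ.+-mono-≤ (potential-≤ n m) (ℚ.p⊓q≤p 1ℚ (⟦ n ⟧ ℚ.* recip m)))

  -- The first `n` units are charged at most 1 each, by `potential-≤`; every later one costs at most
  -- `⟦ n ⟧` times the matching summand of `reciprocals n c`.
  potential-reciprocals : ∀ n c →
    potential n (c ℕ.+ n) ℚ.≤ ⟦ n ⟧ ℚ.* (reciprocals n c + 1ℚ)
  potential-reciprocals n zero    = ℚ.≤-trans (potential-≤ n n) (ℚ.≤-reflexive
    (solve 1 (λ a → a := a :* (con 0ℚ :+ con 1ℚ)) refl ⟦ n ⟧))
  potential-reciprocals n (suc c) = begin
    potential n (c ℕ.+ n) + weight n (c ℕ.+ n)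
      ≤⟨ ℚ.+-mono-≤ (potential-reciprocals n c) (ℚ.p⊓q≤q 1ℚ _) ⟩
    ⟦ n ⟧ ℚ.* (reciprocals n c + 1ℚ) + ⟦ n ⟧ ℚ.* recip (c ℕ.+ n)
      ≡⟨ cong (λ k → ⟦ n ⟧ ℚ.* (reciprocals n c + 1ℚ) + ⟦ n ⟧ ℚ.* recip k) (ℕ.+-comm c n) ⟩
    ⟦ n ⟧ ℚ.* (reciprocals n c + 1ℚ) + ⟦ n ⟧ ℚ.* recip (n ℕ.+ c)
      ≡⟨ solve 3 (λ a b c → a :* (b :+ con 1ℚ) :+ a :* c := a :* (b :+ c :+ con 1ℚ)) refl
           ⟦ n ⟧ (reciprocals n c) (recip (n ℕ.+ c)) ⟩
    ⟦ n ⟧ ℚ.* (reciprocals n (suc c) + 1ℚ) ∎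
    where
    open ℚ.≤-Reasoning

  potential-grows : ∀ n q m c → (∀ i → i < c ℕ.+ m → q ℚ.≤ weight n i) →
    ⟦ c ⟧ ℚ.* q + potential n m ℚ.≤ potential n (c ℕ.+ m)
  potential-grows n q m zero    h = ℚ.≤-reflexive
    (solve 2 (λ a b → con 0ℚ :* a :+ b := b) refl q (potential n m))
  potential-grows n q m (suc c) h = begin
    ⟦ suc c ⟧ ℚ.* q + potential n m
      ≡⟨ cong (λ k → k ℚ.* q + potential n m) (int-suc c) ⟩
    (⟦ c ⟧ + 1ℚ) ℚ.* q + potential n m
      ≡⟨ solve 3 (λ a b c → (a :+ con 1ℚ) :* b :+ c := a :* b :+ c :+ b) refl ⟦ c ⟧ q (potential n m) ⟩
    ⟦ c ⟧ ℚ.* q + potential n m + q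
      ≤⟨ ℚ.+-mono-≤ (potential-grows n q m c (λ i i< → h i (ℕ.m<n⇒m<1+n i<))) (h _ (ℕ.n<1+n _)) ⟩
    potential n (suc c ℕ.+ m) ∎
    where
    open ℚ.≤-Reasoning

  -- Covering `suc r` vertices removes `c` units, and none of them weighs less than the one of index
  -- `e`. So it suffices that c · min(1, n/(e + 1)) is at least `suc d`: the number c is a positive
  -- multiple of `suc d`, and for the other alternative the hypothesis is multiplied by `suc d`.
  potential-drop : ∀ n d u r → suc d * (suc r ℕ.+ u) ≤ n * suc r →
    ⟦ suc d ⟧ + potential n (suc d * u) ℚ.≤ potential n (suc d * (suc r ℕ.+ u))
  potential-drop n d u r du≤nr = begin
    ⟦ suc d ⟧ + potential n m
      ≤⟨ ℚ.+-monoˡ-≤ (potential n m) paid ⟩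
    ⟦ c ⟧ ℚ.* weight n e + potential n m
      ≤⟨ potential-grows n (weight n e) m c
           (λ i i< → weight-anti n (ℕ.s≤s⁻¹ (ℕ.≤-trans i< (ℕ.≤-reflexive c+m≡1+e)))) ⟩
    potential n (c ℕ.+ m)
      ≡⟨ cong (potential n) c+m≡1+e ⟩
    potential n (suc e) ∎
    where
    open ℚ.≤-Reasoning
    m = suc d * u
    c = suc d * suc r
    -- Chosen so that `suc d * (suc r + u)` computes to `suc e`.
    e = r ℕ.+ u ℕ.+ d * (suc r ℕ.+ u)
    c+m≡1+e : c ℕ.+ m ≡ suc e
    c+m≡1+e = sym (ℕ.*-distribˡ-+ (suc d) (suc r) u)

    full : ⟦ suc d ⟧ ℚ.≤ ⟦ c ⟧ ℚ.* 1ℚ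
    full = begin
      ⟦ suc d ⟧     ≤⟨ ⟦⟧-mono (ℕ.m≤m*n (suc d) (suc r)) ⟩
      ⟦ c ⟧         ≡⟨ ℚ.*-identityʳ ⟦ c ⟧ ⟨
      ⟦ c ⟧ ℚ.* 1ℚ  ∎

    fractional : ⟦ suc d ⟧ ℚ.≤ ⟦ c ⟧ ℚ.* (⟦ n ⟧ ℚ.* recip e)
    fractional = begin
      ⟦ suc d ⟧                              ≡⟨ ℚ.*-identityʳ ⟦ suc d ⟧ ⟨
      ⟦ suc d ⟧ ℚ.* 1ℚ                       ≡⟨ cong (⟦ suc d ⟧ ℚ.*_) (⟦suc⟧*recip e) ⟨
      ⟦ suc d ⟧ ℚ.* (⟦ suc e ⟧ ℚ.* recip e)  ≡⟨ ℚ.*-assoc ⟦ suc d ⟧ ⟦ suc e ⟧ (recip e) ⟨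
      ⟦ suc d ⟧ ℚ.* ⟦ suc e ⟧ ℚ.* recip e    ≡⟨ cong (ℚ._* recip e) (⟦⟧-* (suc d) (suc e)) ⟨
      ⟦ suc d * suc e ⟧ ℚ.* recip e
        ≤⟨ ℚ.*-monoʳ-≤-nonNeg (recip e) {{recip-nonNeg e}} (⟦⟧-mono (ℕ.≤-trans
             (ℕ.*-monoʳ-≤ (suc d) du≤nr)
             (ℕ.≤-reflexive (x∙yz≈xz∙y (suc d) n (suc r))))) ⟩
      ⟦ c * n ⟧ ℚ.* recip e                  ≡⟨ cong (ℚ._* recip e) (⟦⟧-* c n) ⟩
      ⟦ c ⟧ ℚ.* ⟦ n ⟧ ℚ.* recip e            ≡⟨ ℚ.*-assoc ⟦ c ⟧ ⟦ n ⟧ (recip e) ⟩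
      ⟦ c ⟧ ℚ.* (⟦ n ⟧ ℚ.* recip e)          ∎
      where open CommSemigroup ℕ.*-commutativeSemigroup using (x∙yz≈xz∙y)

    paid : ⟦ suc d ⟧ ℚ.≤ ⟦ c ⟧ ℚ.* weight n e
    paid = subst (⟦ suc d ⟧ ℚ.≤_)
      (sym (ℚ.*-distribˡ-⊓-nonNeg ⟦ c ⟧ {{⟦⟧-nonNeg c}} 1ℚ (⟦ n ⟧ ℚ.* recip e)))
      (ℚ.⊓-glb full fractional)

open import Data.Nat using (_+_)

-- Averages and cardinalities of finite sets.

sum-mono : ∀ {n} {f g : Fin n → ℕ} → (∀ i → f i ≤ g i) → sum f ≤ sum g
sum-mono {zero}  f≤g = z≤n
sum-mono {suc n} f≤g = ℕ.+-mono-≤ (f≤g zero) (sum-mono (f≤g ∘ suc))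

above-average : ∀ {n} (f : Fin (suc n) → ℕ) → ∃[ i ] sum f ≤ suc n * f i
above-average {zero}  f = zero , ℕ.≤-refl
above-average {suc n} f with above-average (f ∘ suc)
... | j , avg with ℕ.≤-total (f zero) (f (suc j))
...   | inj₁ f0≤ = suc j , ℕ.+-mono-≤ f0≤ avg
...   | inj₂ ≤f0 = zero , ℕ.+-monoʳ-≤ (f zero) (ℕ.≤-trans avg (ℕ.*-monoʳ-≤ (suc n) ≤f0))

indicator : ∀ {n} → Fin n → Subset n → ℕ
indicator v p = if does (v ∈? p) then 1 else 0

∣p∣≡sum : ∀ {n} (p : Subset n) → ∣ p ∣ ≡ sum (λ v → indicator v p)
∣p∣≡sum []            = refl
∣p∣≡sum (inside  ∷ p) = cong suc (∣p∣≡sum p)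
∣p∣≡sum (outside ∷ p) = ∣p∣≡sum p

indicator-∩ : ∀ {n} (v : Fin n) p q → indicator v (p ∩ q) ≡ indicator v p * indicator v q
indicator-∩ v p q = trans
  (cong (if_then 1 else 0)
    (does-⇔ (mk⇔ (x∈p∩q⁻ p q) x∈p∩q⁺) (v ∈? (p ∩ q)) ((v ∈? p) ×-dec (v ∈? q))))
  (if-∧ (does (v ∈? p)) (does (v ∈? q)))
  where
  if-∧ : ∀ a b → (if a ∧ b then 1 else 0) ≡ (if a then 1 else 0) * (if b then 1 else 0)
  if-∧ true  b = sym (ℕ.+-identityʳ _)
  if-∧ false b = refl

∣p∩q∣+∣p─q∣≡∣p∣ : ∀ {n} (p q : Subset n) → ∣ p ∩ q ∣ + ∣ p ─ q ∣ ≡ ∣ p ∣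
∣p∩q∣+∣p─q∣≡∣p∣ []            []            = refl
∣p∩q∣+∣p─q∣≡∣p∣ (outside ∷ p) (outside ∷ q) = ∣p∩q∣+∣p─q∣≡∣p∣ p q
∣p∩q∣+∣p─q∣≡∣p∣ (outside ∷ p) (inside  ∷ q) = ∣p∩q∣+∣p─q∣≡∣p∣ p q
∣p∩q∣+∣p─q∣≡∣p∣ (inside  ∷ p) (outside ∷ q) =
  trans (ℕ.+-suc ∣ p ∩ q ∣ ∣ p ─ q ∣) (cong suc (∣p∩q∣+∣p─q∣≡∣p∣ p q))
∣p∩q∣+∣p─q∣≡∣p∣ (inside  ∷ p) (inside  ∷ q) = cong suc (∣p∩q∣+∣p─q∣≡∣p∣ p q)

∣p∪q∣≤∣p∣+∣q∣ : ∀ {n} (p q : Subset n) → ∣ p ∪ q ∣ ≤ ∣ p ∣ + ∣ q ∣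
∣p∪q∣≤∣p∣+∣q∣ []            []            = z≤n
∣p∪q∣≤∣p∣+∣q∣ (outside ∷ p) (outside ∷ q) = ∣p∪q∣≤∣p∣+∣q∣ p q
∣p∪q∣≤∣p∣+∣q∣ (outside ∷ p) (inside  ∷ q) =
  ℕ.≤-trans (s≤s (∣p∪q∣≤∣p∣+∣q∣ p q)) (ℕ.≤-reflexive (sym (ℕ.+-suc ∣ p ∣ ∣ q ∣)))
∣p∪q∣≤∣p∣+∣q∣ (inside  ∷ p) (outside ∷ q) = s≤s (∣p∪q∣≤∣p∣+∣q∣ p q)
∣p∪q∣≤∣p∣+∣q∣ (inside  ∷ p) (inside  ∷ q) =
  s≤s (ℕ.≤-trans (∣p∪q∣≤∣p∣+∣q∣ p q) (ℕ.+-monoʳ-≤ ∣ p ∣ (ℕ.n≤1+n ∣ q ∣)))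

-- Greedy covering by neighbourhoods.

module Greedy {k} (N : Fin (suc k) → Subset (suc k))
  (N-sym : ∀ {v w} → w ∈ N v → v ∈ N w)
  {d} (d≤∣N∣ : ∀ v → suc d ≤ ∣ N v ∣) where

  n = suc k

  -- Count the pairs with `v ∈ U` and `w ∈ N v`: each `v` occurs in at least `suc d` of them, and by
  -- `N-sym` a given `w` occurs in `∣ U ∩ N w ∣` of them.
  double-count : ∀ U → suc d * ∣ U ∣ ≤ sum (λ w → ∣ U ∩ N w ∣)
  double-count U = begin
    suc d * ∣ U ∣
      ≡⟨ cong (suc d *_) (∣p∣≡sum U) ⟩
    suc d * sum (λ v → indicator v U)
      ≡⟨ *-distribˡ-sum (suc d) (λ v → indicator v U) ⟩
    sum (λ v → suc d * indicator v U)
      ≤⟨ sum-mono (λ v → ℕ.≤-trans (ℕ.*-monoˡ-≤ (indicator v U) (d≤∣N∣ v))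
                                   (ℕ.≤-reflexive (ℕ.*-comm ∣ N v ∣ (indicator v U)))) ⟩
    sum (λ v → indicator v U * ∣ N v ∣)
      ≡⟨ sum-cong-≗ (λ v → trans (cong (indicator v U *_) (∣p∣≡sum (N v)))
                                 (*-distribˡ-sum (indicator v U) (λ w → indicator w (N v)))) ⟩
    sum (λ v → sum (λ w → indicator v U * indicator w (N v)))
      ≡⟨ ∑-comm (λ v w → indicator v U * indicator w (N v)) ⟩
    sum (λ w → sum (λ v → indicator v U * indicator w (N v)))
      ≡⟨ sum-cong-≗ (λ w → sum-cong-≗ (λ v →
           trans (cong (λ b → indicator v U * (if b then 1 else 0))
                       (does-⇔ (mk⇔ N-sym N-sym) (w ∈? N v) (v ∈? N w)))
                 (sym (indicator-∩ v U (N w))))) ⟩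
    sum (λ w → sum (λ v → indicator v (U ∩ N w)))
      ≡⟨ sum-cong-≗ (λ w → ∣p∣≡sum (U ∩ N w)) ⟨
    sum (λ w → ∣ U ∩ N w ∣) ∎
    where open ℕ.≤-Reasoning

  -- The list is charged to the potential of `U` instead of being bounded outright, so that a greedy
  -- step adds `suc d` on the left and at least as much on the right.
  Cover : Subset n → Set
  Cover U = ∃[ L ] (∀ v → v ∈ U → ∃[ w ] w List.∈ L × w ∈ N v)
                 × ⟦ suc d * length L ⟧ ℚ.≤ potential n (suc d * ∣ U ∣)

  -- By `N-sym` the vertex `w` serves all of `N w`, so only `U ─ N w` is left to `L`; the drop of
  -- the potential from `U` to `U ─ N w` pays for the new entry.
  cover-step : ∀ U w r → ∣ U ∩ N w ∣ ≡ suc r → suc d * ∣ U ∣ ≤ n * suc r →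
               Cover (U ─ N w) → Cover U
  cover-step U w r ∣∩∣≡ large (L , covers , cheap) = w ∷ L , covers′ , cheap′
    where
    covers′ : ∀ v → v ∈ U → ∃[ x ] x List.∈ (w ∷ L) × x ∈ N v
    covers′ v v∈U with v ∈? N w
    ... | yes v∈Nw = w , here refl , N-sym v∈Nw
    ... | no  v∉Nw =
      let x , x∈L , x∈Nv = covers v (x∈p∧x∉q⇒x∈p─q v∈U v∉Nw) in x , there x∈L , x∈Nv

    split-U : ∣ U ∣ ≡ suc r + ∣ U ─ N w ∣
    split-U = trans (sym (∣p∩q∣+∣p─q∣≡∣p∣ U (N w))) (cong (_+ ∣ U ─ N w ∣) ∣∩∣≡)

    cheap′ : ⟦ suc d * suc (length L) ⟧ ℚ.≤ potential n (suc d * ∣ U ∣)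
    cheap′ = begin
      ⟦ suc d * suc (length L) ⟧
        ≡⟨ cong ⟦_⟧ (ℕ.*-suc (suc d) (length L)) ⟩
      ⟦ suc d + suc d * length L ⟧
        ≡⟨ ⟦⟧-+ (suc d) (suc d * length L) ⟩
      ⟦ suc d ⟧ ℚ.+ ⟦ suc d * length L ⟧
        ≤⟨ ℚ.+-monoʳ-≤ ⟦ suc d ⟧ cheap ⟩
      ⟦ suc d ⟧ ℚ.+ potential n (suc d * ∣ U ─ N w ∣)
        ≤⟨ potential-drop n d ∣ U ─ N w ∣ r
             (subst (λ u → suc d * u ≤ n * suc r) split-U large) ⟩
      potential n (suc d * (suc r + ∣ U ─ N w ∣))
        ≡⟨ cong (λ u → potential n (suc d * u)) split-U ⟨
      potential n (suc d * ∣ U ∣) ∎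
      where open ℚ.≤-Reasoning

  -- The recursion is on a bound for `∣ U ∣`: a vertex of at least average gain removes some element
  -- of a nonempty `U`.
  cover : ∀ fuel U → ∣ U ∣ ≤ fuel → Cover U
  cover fuel U U≤ with nonempty? U
  cover fuel U U≤ | no empty = [] , (λ v v∈U → contradiction (v , v∈U) empty) , (begin
    ⟦ suc d * 0 ⟧                ≡⟨ cong ⟦_⟧ (ℕ.*-zeroʳ (suc d)) ⟩
    0ℚ                           ≡⟨⟩
    potential n 0                ≡⟨ cong (potential n) (ℕ.*-zeroʳ (suc d)) ⟨
    potential n (suc d * 0)      ≡⟨ cong (λ u → potential n (suc d * u)) (∣⊥∣≡0 n) ⟨
    potential n (suc d * ∣ ⊥ {n} ∣) ≡⟨ cong (λ p → potential n (suc d * ∣ p ∣)) (Empty-unique empty) ⟨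
    potential n (suc d * ∣ U ∣)  ∎)
    where open ℚ.≤-Reasoning
  cover zero U U≤ | yes (v , v∈U) =
    contradiction (ℕ.<-≤-trans (x∈p⇒∣p-x∣<∣p∣ v∈U) U≤) λ()
  cover (suc fuel) U U≤ | yes (v , v∈U)
    with above-average (λ w → ∣ U ∩ N w ∣)
  ... | w , avg with ∣ U ∩ N w ∣ in eq
  -- Were the gain zero, double counting would give `∣ U ∣` ≤ 0, although `v ∈ U`.
  ...   | zero  = contradiction (ℕ.<-≤-trans (ℕ.≤-trans (s≤s z≤n) (x∈p⇒∣p-x∣<∣p∣ v∈U)) (begin
            ∣ U ∣            ≤⟨ ℕ.m≤m+n ∣ U ∣ (d * ∣ U ∣) ⟩
            suc d * ∣ U ∣    ≤⟨ ℕ.≤-trans (double-count U) avg ⟩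
            n * 0            ≡⟨ ℕ.*-zeroʳ n ⟩
            0                ∎)) λ()
          where open ℕ.≤-Reasoning
  ...   | suc r = cover-step U w r eq (ℕ.≤-trans (double-count U) avg)
                    (cover fuel (U ─ N w) (ℕ.s≤s⁻¹ (ℕ.≤-trans (begin
            suc ∣ U ─ N w ∣        ≤⟨ s≤s (ℕ.m≤n+m ∣ U ─ N w ∣ r) ⟩
            suc r + ∣ U ─ N w ∣    ≡⟨ cong (_+ ∣ U ─ N w ∣) eq ⟨
            ∣ U ∩ N w ∣ + ∣ U ─ N w ∣ ≡⟨ ∣p∩q∣+∣p─q∣≡∣p∣ U (N w) ⟩
            ∣ U ∣                  ∎) U≤)))
          where open ℕ.≤-Reasoning

  -- Starting from `⊤` there are `suc d * n` units, that is `d * n` beyond the first `n`. As `n` is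
  -- `suc k`, the sum `reciprocals n (d * n)` is by definition the term of index `k` of
  -- `lnSeq (suc d)`.
  hitting-list : ∃[ L ] (∀ v → ∃[ w ] w List.∈ L × w ∈ N v)
               × ⟦ suc d * length L ⟧ ℚ.≤ ⟦ n ⟧ ℚ.* (lnSeq (suc d) k ℚ.+ 1ℚ)
  hitting-list =
    let L , covers , cheap = cover n ⊤ (ℕ.≤-reflexive (∣⊤∣≡n n))
    in L , (λ v → covers v ∈⊤) , (begin
      ⟦ suc d * length L ⟧                 ≤⟨ cheap ⟩
      potential n (suc d * ∣ ⊤ {n} ∣)      ≡⟨ cong (λ u → potential n (suc d * u)) (∣⊤∣≡n n) ⟩
      potential n (n + d * n)              ≡⟨ cong (potential n) (ℕ.+-comm n (d * n)) ⟩
      potential n (d * n + n)              ≤⟨ potential-reciprocals n (d * n) ⟩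
      ⟦ n ⟧ ℚ.* (lnSeq (suc d) k ℚ.+ 1ℚ)   ∎)
    where open ℚ.≤-Reasoning

-- Neighbourhoods, and sets closed under the matching.

module _ {n} (G : Graph n) where
  open Graph G

  ~⇒∈neighbours : ∀ {v w} → v ~ w → w ∈ neighbours G v
  ~⇒∈neighbours {v} {w} v~w = lookup⇒[]= w (neighbours G v)
    (trans (lookup∘tabulate (λ u → does (v ~? u)) w) (dec-true (v ~? w) v~w))

  ∈neighbours⇒~ : ∀ {v w} → w ∈ neighbours G v → v ~ w
  ∈neighbours⇒~ {v} {w} w∈ = invert (subst (Reflects (v ~ w))
    (trans (sym (lookup∘tabulate (λ u → does (v ~? u)) w)) ([]=⇒lookup w∈)) (proof (v ~? w)))

  neighbours-sym : ∀ {v w} → w ∈ neighbours G v → v ∈ neighbours G w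
  neighbours-sym = ~⇒∈neighbours ∘ ~-sym ∘ ∈neighbours⇒~

  closedNeighbours : Fin n → Subset n
  closedNeighbours v = ⁅ v ⁆ ∪ neighbours G v

  closedNeighbours-sym : ∀ {v w} → w ∈ closedNeighbours v → v ∈ closedNeighbours w
  closedNeighbours-sym {v} {w} w∈ with x∈p∪q⁻ ⁅ v ⁆ (neighbours G v) w∈
  ... | inj₁ w∈⁅v⁆ = x∈p∪q⁺ (inj₁ (subst (λ x → v ∈ ⁅ x ⁆) (sym (x∈⁅y⁆⇒x≡y v w∈⁅v⁆)) (x∈⁅x⁆ v)))
  ... | inj₂ w∈N   = x∈p∪q⁺ (inj₂ (neighbours-sym w∈N))

  -- Irreflexivity keeps `v` out of its open neighbourhood; this yields the δ + 1 of the first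
  -- bound.
  degree<∣closedNeighbours∣ : ∀ v → degree G v < ∣ closedNeighbours v ∣
  degree<∣closedNeighbours∣ v = p⊂q⇒∣p∣<∣q∣
    ( q⊆p∪q ⁅ v ⁆ (neighbours G v)
    , v , x∈p∪q⁺ (inj₁ (x∈⁅x⁆ v)) , ~-irr refl ∘ ∈neighbours⇒~ )

  -- The matching being symmetric, the complement is closed as well, so a covered vertex outside `X`
  -- has a neighbour outside `X`.
  Closed : Matching G → Subset n → Set
  Closed M X = ∀ {u v} → v ∈ X → Matching._—_ M v u → u ∈ X

  -- `E` consists of what the matching misses: nothing for even `n`, one vertex for odd `n`. A
  -- missed vertex has no partner, so its singleton is closed vacuously. This is the source of the
  -- summand ε.
  exceptional : ∀ M → IsPerfect G M →
    ∃[ E ] ∣ E ∣ ≤ n % 2 × Closed M E × (∀ v → v ∉ E → Matching.Covers M v)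
  exceptional M (even , odd) with n % 2 in eq | ℕ.m%n<n n 2
  ... | 0 | _ = ⊥ , ℕ.≤-reflexive (∣⊥∣≡0 n) , (λ v∈⊥ → contradiction v∈⊥ ∉⊥)
              , (λ v _ → even refl v)
  ... | 1 | _ =
    let u , u-free , rest = odd refl
    in ⁅ u ⁆ , ℕ.≤-reflexive (∣⁅x⁆∣≡1 u)
     , (λ v∈ v—w → contradiction
          (_ , subst (λ x → Matching._—_ M x _) (x∈⁅y⁆⇒x≡y u v∈) v—w) u-free)
     , (λ v v∉ → rest v (x∉⁅y⁆⇒x≢y v∉))
  ... | suc (suc _) | s≤s (s≤s ())

  -- Partners are unique, so a matching edge from either end of the pair leads to the other end.
  matched-pair : ∀ M {v u} → Matching._—_ M v u →
    ∃[ P ] v ∈ P × ∣ P ∣ ≤ 2 × Closed M P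
  matched-pair M {v} {u} v—u =
      ⁅ v ⁆ ∪ ⁅ u ⁆
    , x∈p∪q⁺ (inj₁ (x∈⁅x⁆ v))
    , ℕ.≤-trans (∣p∪q∣≤∣p∣+∣q∣ ⁅ v ⁆ ⁅ u ⁆)
                (ℕ.≤-reflexive (cong₂ _+_ (∣⁅x⁆∣≡1 v) (∣⁅x⁆∣≡1 u)))
    , closed
    where
    open Matching M
    closed : Closed M (⁅ v ⁆ ∪ ⁅ u ⁆)
    closed {y} {x} x∈ x—y with x∈p∪q⁻ ⁅ v ⁆ ⁅ u ⁆ x∈
    ... | inj₁ x∈⁅v⁆ = x∈p∪q⁺ (inj₂ (subst (_∈ ⁅ u ⁆)
      (—-unique v—u (subst (_— y) (x∈⁅y⁆⇒x≡y v x∈⁅v⁆) x—y)) (x∈⁅x⁆ u)))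
    ... | inj₂ x∈⁅u⁆ = x∈p∪q⁺ (inj₁ (subst (_∈ ⁅ v ⁆)
      (—-unique (—-sym v—u) (subst (_— y) (x∈⁅y⁆⇒x≡y u x∈⁅u⁆) x—y)) (x∈⁅x⁆ v)))

  Closed-∪ : ∀ M {X Y} → Closed M X → Closed M Y → Closed M (X ∪ Y)
  Closed-∪ M {X} {Y} cX cY v∈ v—u with x∈p∪q⁻ X Y v∈
  ... | inj₁ v∈X = x∈p∪q⁺ (inj₁ (cX v∈X v—u))
  ... | inj₂ v∈Y = x∈p∪q⁺ (inj₂ (cY v∈Y v—u))

  -- The construction starts from the exceptional set, so every vertex still outside has a partner.
  -- A list entry already in `X` costs nothing; any other brings in its pair, at most 2 new
  -- vertices.
  closure : ∀ M → IsPerfect G M → (L : List (Fin n)) →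
    ∃[ X ] (∀ {v} → v List.∈ L → v ∈ X) × ∣ X ∣ ≤ 2 * length L + n % 2
         × Closed M X × (∀ v → v ∉ X → Matching.Covers M v)
  closure M perfect [] =
    let E , ∣E∣≤ , cE , covers = exceptional M perfect in E , (λ ()) , ∣E∣≤ , cE , covers
  closure M perfect (w ∷ L) with closure M perfect L
  ... | X , L⊆X , ∣X∣≤ , cX , covers with w ∈? X
  ...   | yes w∈X = X , (λ { (here refl) → w∈X ; (there v∈L) → L⊆X v∈L })
                  , ℕ.≤-trans ∣X∣≤ (ℕ.+-monoˡ-≤ (n % 2) (ℕ.*-monoʳ-≤ 2 (ℕ.n≤1+n (length L))))
                  , cX , covers
  ...   | no  w∉X =
    let P , w∈P , ∣P∣≤2 , cP = matched-pair M (proj₂ (covers w w∉X))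
    in P ∪ X
     , (λ { (here refl) → x∈p∪q⁺ (inj₁ w∈P) ; (there v∈L) → x∈p∪q⁺ (inj₂ (L⊆X v∈L)) })
     , (begin
          ∣ P ∪ X ∣                        ≤⟨ ∣p∪q∣≤∣p∣+∣q∣ P X ⟩
          ∣ P ∣ + ∣ X ∣                    ≤⟨ ℕ.+-mono-≤ ∣P∣≤2 ∣X∣≤ ⟩
          2 + (2 * length L + n % 2)       ≡⟨ cong (_+ n % 2) (ℕ.*-suc 2 (length L)) ⟨
          2 * suc (length L) + n % 2       ∎)
     , Closed-∪ M cP cX
     , (λ v v∉ → covers v (v∉ ∘ x∈p∪q⁺ ∘ inj₂))
    where open ℕ.≤-Reasoning

  -- Shared by both bounds: domination is inherited from the list by any larger set, and the
  -- matching supplies the restrained condition.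
  restrained-superset : HasPerfectMatching G → (L : List (Fin n)) →
    ∃[ X ] (∀ {v} → v List.∈ L → v ∈ X) × ∣ X ∣ ≤ 2 * length L + n % 2
         × (∀ v → v ∉ X → ∃[ u ] u ∉ X × v ~ u)
  restrained-superset (M , perfect) L =
    let X , L⊆X , ∣X∣≤ , cX , covers = closure M perfect L
    in X , L⊆X , ∣X∣≤ , λ v v∉X →
       let u , v—u = covers v v∉X
       in u , (λ u∈X → v∉X (cX u∈X (Matching.—-sym M v—u))) , Matching.—⇒~ M v—u

-- From the rational estimate to the inequality of reals.

-- The given estimate involves the single term of index `k`, whereas `≤ᴿ` concerns all late terms.
-- By `compare`, term `k` exceeds term `j` by at most `recip j`, and this excess, scaled by 2n/(d +
-- 1), falls below η for large `j`.
ln-bound : ∀ k d s ε → let n = suc k in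
  ⟦ suc d * s ⟧ ℚ.≤ ⟦ n ⟧ ℚ.* (lnSeq (suc d) k ℚ.+ 1ℚ) →
  ∀ γ → γ ≤ 2 * s + ε →
  fromℕ γ ≤ᴿ (ln (suc d) +ᴿ fromℕ 1) /ᴿ suc d *ᴿ fromℕ (2 * n) +ᴿ fromℕ ε
ln-bound k d s ε cheap γ γ≤ η η>0 with recip-small η η>0
-- Since `suc l` is 2n, the threshold is the predecessor of 2n(N + 1); from there on, 2n times
-- `recip j` is at most `recip N`.
... | N , 1/N<η = N + l * suc N , λ j j≥ → begin
  ⟦ γ ⟧
    ≤⟨ ⟦⟧-mono γ≤ ⟩
  ⟦ 2 * s + ε ⟧
    ≡⟨ trans (⟦⟧-+ (2 * s) ε) (cong (ℚ._+ ⟦ ε ⟧) (⟦⟧-* 2 s)) ⟩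
  ⟦ 2 ⟧ ℚ.* ⟦ s ⟧ ℚ.+ ⟦ ε ⟧
    ≤⟨ ℚ.+-monoˡ-≤ ⟦ ε ⟧ (ℚ.*-monoˡ-≤-nonNeg ⟦ 2 ⟧ s≤) ⟩
  ⟦ 2 ⟧ ℚ.* (recip d ℚ.* (⟦ n ⟧ ℚ.* (lnSeq (suc d) k ℚ.+ 1ℚ))) ℚ.+ ⟦ ε ⟧
    ≡⟨ solve 5 (λ t r n l e → t :* (r :* (n :* l)) :+ e := l :* (r :* (t :* n)) :+ e) refl
         ⟦ 2 ⟧ (recip d) ⟦ n ⟧ (lnSeq (suc d) k ℚ.+ 1ℚ) ⟦ ε ⟧ ⟩
  (lnSeq (suc d) k ℚ.+ 1ℚ) ℚ.* (recip d ℚ.* (⟦ 2 ⟧ ℚ.* ⟦ n ⟧)) ℚ.+ ⟦ ε ⟧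
    ≡⟨ cong (λ m → (lnSeq (suc d) k ℚ.+ 1ℚ) ℚ.* (recip d ℚ.* m) ℚ.+ ⟦ ε ⟧) (⟦⟧-* 2 n) ⟨
  (lnSeq (suc d) k ℚ.+ 1ℚ) ℚ.* (recip d ℚ.* ⟦ 2 * n ⟧) ℚ.+ ⟦ ε ⟧
    ≤⟨ ℚ.+-monoˡ-≤ ⟦ ε ⟧ (ℚ.*-monoʳ-≤-nonNeg (recip d ℚ.* ⟦ 2 * n ⟧) {{factor-nonNeg}}
         (ℚ.+-monoˡ-≤ 1ℚ (compare (suc d) k j))) ⟩
  (lnSeq (suc d) j ℚ.+ recip j ℚ.+ 1ℚ) ℚ.* (recip d ℚ.* ⟦ 2 * n ⟧) ℚ.+ ⟦ ε ⟧
    ≡⟨ solve 5 (λ l q r m e → (l :+ q :+ con 1ℚ) :* (r :* m) :+ e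
                            := ((l :+ con 1ℚ) :* r :* m :+ e) :+ r :* (m :* q)) refl
         (lnSeq (suc d) j) (recip j) (recip d) ⟦ 2 * n ⟧ ⟦ ε ⟧ ⟩
  rhs j ℚ.+ recip d ℚ.* (⟦ 2 * n ⟧ ℚ.* recip j)
    ≤⟨ ℚ.+-monoʳ-≤ (rhs j) (error j j≥) ⟩
  rhs j ℚ.+ η ∎
  where
  open ℚ.≤-Reasoning
  n = suc k
  l = k + suc (k + 0)
  rhs : ℕ → ℚ
  rhs j = (lnSeq (suc d) j ℚ.+ 1ℚ) ℚ.* recip d ℚ.* ⟦ 2 * n ⟧ ℚ.+ ⟦ ε ⟧

  factor-nonNeg : ℚ.NonNegative (recip d ℚ.* ⟦ 2 * n ⟧)
  factor-nonNeg = ℚ.nonNeg*nonNeg⇒nonNeg (recip d) {{recip-nonNeg d}} ⟦ 2 * n ⟧ {{⟦⟧-nonNeg (2 * n)}}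

  s≤ : ⟦ s ⟧ ℚ.≤ recip d ℚ.* (⟦ n ⟧ ℚ.* (lnSeq (suc d) k ℚ.+ 1ℚ))
  s≤ = begin
    ⟦ s ⟧                               ≡⟨ ℚ.*-identityˡ ⟦ s ⟧ ⟨
    1ℚ ℚ.* ⟦ s ⟧                        ≡⟨ cong (ℚ._* ⟦ s ⟧) (⟦suc⟧*recip d) ⟨
    ⟦ suc d ⟧ ℚ.* recip d ℚ.* ⟦ s ⟧     ≡⟨ solve 3 (λ a b c → a :* b :* c := b :* (a :* c)) refl
                                             ⟦ suc d ⟧ (recip d) ⟦ s ⟧ ⟩
    recip d ℚ.* (⟦ suc d ⟧ ℚ.* ⟦ s ⟧)   ≡⟨ cong (recip d ℚ.*_) (⟦⟧-* (suc d) s) ⟨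
    recip d ℚ.* ⟦ suc d * s ⟧           ≤⟨ ℚ.*-monoˡ-≤-nonNeg (recip d) {{recip-nonNeg d}} cheap ⟩
    recip d ℚ.* (⟦ n ⟧ ℚ.* (lnSeq (suc d) k ℚ.+ 1ℚ)) ∎

  error : ∀ j → N + l * suc N ≤ j → recip d ℚ.* (⟦ 2 * n ⟧ ℚ.* recip j) ℚ.≤ η
  error j j≥ = begin
    recip d ℚ.* (⟦ 2 * n ⟧ ℚ.* recip j)
      ≤⟨ ℚ.*-monoˡ-≤-nonNeg (recip d) {{recip-nonNeg d}}
           (ℚ.*-monoˡ-≤-nonNeg ⟦ 2 * n ⟧ {{⟦⟧-nonNeg (2 * n)}} (recip-anti j≥)) ⟩
    recip d ℚ.* (⟦ suc l ⟧ ℚ.* recip (N + l * suc N))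
      ≡⟨ cong (recip d ℚ.*_) (int*recip l N) ⟩
    recip d ℚ.* recip N
      -- `recip d` is at most `recip 0`, which computes to `1ℚ`.
      ≤⟨ ℚ.*-monoʳ-≤-nonNeg (recip N) {{recip-nonNeg N}} (recip-anti {0} {d} z≤n) ⟩
    1ℚ ℚ.* recip N
      ≡⟨ ℚ.*-identityˡ (recip N) ⟩
    recip N
      ≤⟨ ℚ.<⇒≤ 1/N<η ⟩
    η ∎

-- The two domination bounds.

restrained-bound : ∀ {n} (G : Graph n) δ → IsMinDegree G δ → HasPerfectMatching G →
  ∀ γ → IsRestrainedDominationNumber G γ →
  fromℕ γ ≤ᴿ (ln (suc δ) +ᴿ fromℕ 1) /ᴿ suc δ *ᴿ fromℕ (2 * n) +ᴿ fromℕ (n % 2)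
-- The minimum degree is attained at some vertex, which excludes order zero.
restrained-bound {zero}  G δ ((() , _) , _)
restrained-bound {suc k} G δ (_ , δ≤) pm γ (_ , γ-min) =
  let L , hits , cheap = Greedy.hitting-list (closedNeighbours G) (closedNeighbours-sym G)
                           (λ v → ℕ.≤-trans (s≤s (δ≤ v)) (degree<∣closedNeighbours∣ G v))
      X , L⊆X , ∣X∣≤ , restrained = restrained-superset G pm L

      dominating : IsDominating G X
      dominating v v∉X =
        let w , w∈L , w∈N = hits v
        in case x∈p∪q⁻ ⁅ v ⁆ (neighbours G v) w∈N of λ where
             -- If the chosen vertex is `v` itself, then `v` lies in `X` after all.
             (inj₁ w∈⁅v⁆) → contradiction (subst (_∈ X) (x∈⁅y⁆⇒x≡y v w∈⁅v⁆) (L⊆X w∈L)) v∉X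
             (inj₂ w∈N)   → w , L⊆X w∈L , ∈neighbours⇒~ G w∈N
  in ln-bound k δ (length L) (suc k % 2) cheap γ
       (ℕ.≤-trans (γ-min X (dominating , restrained)) ∣X∣≤)

-- A list that hits all open neighbourhoods gives every vertex, in `X` or not, a neighbour in `X`,
-- so domination and totality come together. Open neighbourhoods are only guaranteed δ elements,
-- whence δ in place of δ + 1.
total-restrained-bound : ∀ {n} (G : Graph n) d → IsMinDegree G (suc d) → HasPerfectMatching G →
  ∀ γ → IsTotalRestrainedDominationNumber G γ →
  fromℕ γ ≤ᴿ (ln (suc d) +ᴿ fromℕ 1) /ᴿ suc d *ᴿ fromℕ (2 * n) +ᴿ fromℕ (n % 2)
total-restrained-bound {zero}  G d ((() , _) , _)
total-restrained-bound {suc k} G d (_ , δ≤) pm γ (_ , γ-min) =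
  let L , hits , cheap = Greedy.hitting-list (neighbours G) (neighbours-sym G) δ≤
      X , L⊆X , ∣X∣≤ , restrained = restrained-superset G pm L

      total : ∀ v → ∃[ u ] u ∈ X × Graph._~_ G v u
      total v = let w , w∈L , w∈N = hits v in w , L⊆X w∈L , ∈neighbours⇒~ G w∈N
  in ln-bound k d (length L) (suc k % 2) cheap γ
       (ℕ.≤-trans (γ-min X (((λ v _ → total v) , restrained) , λ v _ → total v)) ∣X∣≤)

corollary3 : ∀ {n} (G : Graph n) (δ : ℕ) → IsMinDegree G δ → HasPerfectMatching G →
    (∀ γr → IsRestrainedDominationNumber G γr →
    fromℕ γr ≤ᴿ (ln (suc δ) +ᴿ fromℕ 1) /ᴿ suc δ *ᴿ fromℕ (2 * n) +ᴿ fromℕ (n % 2))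
    ×
    (.{{_ : NonZero δ}} → ∀ γtr → IsTotalRestrainedDominationNumber G γtr →
    fromℕ γtr ≤ᴿ (ln δ +ᴿ fromℕ 1) /ᴿ δ *ᴿ fromℕ (2 * n) +ᴿ fromℕ (n % 2))
corollary3 G zero    δ-min pm =
  restrained-bound G zero δ-min pm , λ {{nz}} → contradiction refl (ℕ.≢-nonZero⁻¹ 0 {{nz}})
corollary3 G (suc d) δ-min pm =
  restrained-bound G (suc d) δ-min pm , total-restrained-bound G d δ-min pm
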